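{- The system $\mathbf{K4}^\blacktriangle$ is sound and strongly complete with respect to the class of transitive frames ($4$-frames); thus it is also sound and strongly complete with respect to the class of reflexive and transitive frames ($\mathcal{S}4$-frames).
   Context: Let $\mathbf{P}$ be a set of propositional variables. $\mathcal{L}(\blacktriangle)$-formulas: $\varphi::=\top\mid p\mid\neg\varphi\mid(\varphi\land\varphi)\mid\blacktriangle\varphi$ with $p\in\mathbf{P}$; other Boolean connectives are defined as usual. A frame is $\langle S,R\rangle$ with $S$ nonempty and $R\subseteq S\times S$; a model on it adds a valuation $V:\mathbf{P}\to\mathcal{P}(S)$. Truth: $\top$, variables, $\neg$, $\land$ as usual; $\mathcal{M},s\vDash\blacktriangle\varphi$ iff (if $\mathcal{M},s\vDash\varphi$ then $\mathcal{M},t\vDash\varphi$ for all $t$ with $sRt$) and (if $\mathcal{M},s\nvDash\varphi$ then $\mathcal{M},t\nvDash\varphi$ for all $t$ with $sRt$). $\Gamma$ entails $\varphi$ over a class of frames if $\Gamma\cup\{\neg\varphi\}$ is not satisfied at any point of any model based on a frame in the class. The axiomatic system $\mathbf{K}^\blacktriangle$ consists of all propositional tautologies, uniform substitution, modus ponens, plus the axioms (with $p,q$ propositional variables) $\blacktriangle\top$; $\ \blacktriangle\neg p\leftrightarrow\blacktriangle p$; $\ \blacktriangle p\land\blacktriangle q\to\blacktriangle(p\land q)$; and the inference rule R: from $\varphi\to\psi$ infer $\blacktriangle\varphi\land\varphi\to\blacktriangle\psi$. $\mathbf{K4}^\blacktriangle$ is $\mathbf{K}^\blacktriangle$ plus the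 axiom $\blacktriangle p\to\blacktriangle\blacktriangle p$. A derivation from $\Gamma$ to $\varphi$ in the system, notation $\Gamma\vdash\varphi$, is a finite sequence of $\mathcal{L}(\blacktriangle)$-formulas (ending in $\varphi$) in which each formula is either an instantiation of an axiom, or an element of $\Gamma$, or the result of applying an inference rule to prior formulas in the sequence. A theorem is a formula derivable from the empty set. Sound with respect to a class of frames: every theorem is valid on every frame of the class. Strongly complete with respect to a class: for all $\Gamma\cup\{\varphi\}\subseteq\mathcal{L}(\blacktriangle)$, if $\Gamma$ entails $\varphi$ over the class then $\Gamma\vdash\varphi$. -}

module Defs where

open import Data.Bool using (Bool; true; not) renaming (_∧_ to _&&_)
open import Data.List using (List; []; _∷_)
open import Data.List.Membership.Propositional using () renaming (_∈_ to _∈ₗ_)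
open import Data.Nat using (ℕ)
open import Data.Product using (_×_; ∃-syntax)
import Data.Unit as Unit
open import Level using (0ℓ)
open import Relation.Binary.Core using (Rel)
open import Relation.Binary.Definitions using (Reflexive; Transitive)
open import Relation.Binary.PropositionalEquality using (_≡_)
open import Relation.Nullary using (¬_)
open import Relation.Unary using (Pred; _∈_; _⊆_; _∪_; _∩_; ｛_｝; ∅)

infix  30 ~_ ▲_
infixr 25 _∧_
infixr 20 _⇒_
infix  19 _⇔_
infix  35 _[_]
infix  4  _,_⊨_ _⊩_

data Form (P : Set) : Set where
  ⊤   : Form P
  var : P → Form P
  ~_  : Form P → Form P
  _∧_ : Form P → Form P → Form P
  ▲_  : Form P → Form P

_⇒_ _⇔_ : ∀ {P} → Form P → Form P → Form P
φ ⇒ ψ = ~ (φ ∧ ~ ψ)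
φ ⇔ ψ = (φ ⇒ ψ) ∧ (ψ ⇒ φ)

_[_] : ∀ {P Q} → Form P → (P → Form Q) → Form Q
⊤       [ σ ] = ⊤
var p   [ σ ] = σ p
(~ φ)   [ σ ] = ~ (φ [ σ ])
(φ ∧ ψ) [ σ ] = (φ [ σ ]) ∧ (ψ [ σ ])
(▲ φ)   [ σ ] = ▲ (φ [ σ ])

record Frame : Set₁ where
  field
    S        : Set
    nonempty : S
    R        : Rel S 0ℓ

record Model (P : Set) : Set₁ where
  constructor ⟨_,_⟩
  field
    frame : Frame
    V     : P → Pred (Frame.S frame) 0ℓ
  open Frame frame public

_,_⊨_ : ∀ {P} (M : Model P) → Model.S M → Form P → Set
M , s ⊨ ⊤     = Unit.⊤
M , s ⊨ var p = s ∈ Model.V M p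
M , s ⊨ ~ φ   = ¬ (M , s ⊨ φ)
M , s ⊨ φ ∧ ψ = (M , s ⊨ φ) × (M , s ⊨ ψ)
M , s ⊨ ▲ φ   =
    (M , s ⊨ φ → ∀ t → Model.R M s t → M , t ⊨ φ)
  × (¬ (M , s ⊨ φ) → ∀ t → Model.R M s t → ¬ (M , t ⊨ φ))

FrameClass : Set₁
FrameClass = Pred Frame 0ℓ

_⊩_ : ∀ {P} → Frame → Form P → Set₁
F ⊩ φ = ∀ V s → ⟨ F , V ⟩ , s ⊨ φ

Entails : ∀ {P} → FrameClass → Pred (Form P) 0ℓ → Form P → Set₁
Entails C Γ φ =
  ∀ F → F ∈ C → ∀ V s → ¬ ((Γ ∪ ｛ ~ φ ｝) ⊆ (⟨ F , V ⟩ , s ⊨_))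

4-frames S4-frames : FrameClass
4-frames F = Transitive (Frame.R F)
S4-frames  = (λ F → Reflexive (Frame.R F)) ∩ 4-frames

data Propositional {P : Set} : Form P → Set where
  ⊤   : Propositional ⊤
  var : ∀ p → Propositional (var p)
  ~_  : ∀ {φ} → Propositional φ → Propositional (~ φ)
  _∧_ : ∀ {φ ψ} → Propositional φ → Propositional ψ → Propositional (φ ∧ ψ)

truthValue : ∀ {P} {φ : Form P} → Propositional φ → (P → Bool) → Bool
truthValue ⊤       v = true
truthValue (var p) v = v p
truthValue (~ a)   v = not (truthValue a v)
truthValue (a ∧ b) v = truthValue a v && truthValue b v

Tautology : ∀ {P} → Form P → Set
Tautology φ = ∃[ a ] (∀ v → truthValue {φ = φ} a v ≡ true)

-- Axioms are written in a countable stock of schematic letters rather than in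
-- the given variables P: uniform substitution replaces these letters by
-- arbitrary formulas over P.  (With literal variables, the two-letter axiom
-- would be unavailable when P has fewer than two elements.)
p q : Form ℕ
p = var 0
q = var 1

data K▲ : Pred (Form ℕ) 0ℓ where
  taut : ∀ {α} → Tautology α → K▲ α
  ▲⊤   : K▲ (▲ ⊤)
  ▲~   : K▲ (▲ ~ p ⇔ ▲ p)
  ▲∧   : K▲ (▲ p ∧ ▲ q ⇒ ▲ (p ∧ q))

K4▲ : Pred (Form ℕ) 0ℓ
K4▲ = K▲ ∪ ｛ ▲ p ⇒ ▲ ▲ p ｝

module _ {P : Set} where

  Instance : Pred (Form ℕ) 0ℓ → Pred (Form P) 0ℓ
  Instance Ax φ = ∃[ α ] ∃[ σ ] (α ∈ Ax × φ ≡ α [ σ ])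

  data Step (Ax : Pred (Form ℕ) 0ℓ) (Γ : Pred (Form P) 0ℓ)
            (prior : List (Form P)) : Form P → Set where
    axiom : ∀ {φ} → Instance Ax φ → Step Ax Γ prior φ
    hyp   : ∀ {φ} → φ ∈ Γ → Step Ax Γ prior φ
    mp    : ∀ {φ ψ} → (φ ⇒ ψ) ∈ₗ prior → φ ∈ₗ prior → Step Ax Γ prior ψ
    R     : ∀ {φ ψ} → (φ ⇒ ψ) ∈ₗ prior → Step Ax Γ prior (▲ φ ∧ φ ⇒ ▲ ψ)

  -- Sequences are listed with the latest formula at the head.
  data Derivation (Ax : Pred (Form ℕ) 0ℓ) (Γ : Pred (Form P) 0ℓ) :
                  List (Form P) → Set where
    []  : Derivation Ax Γ []
    _∷_ : ∀ {φ φs} → Step Ax Γ φs φ → Derivation Ax Γ φs → Derivation Ax Γ (φ ∷ φs)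

  -- Hypotheses may feed rule R as well as modus ponens, so this is the global
  -- notion of derivability from Γ.
  Derivable : Pred (Form ℕ) 0ℓ → Pred (Form P) 0ℓ → Form P → Set
  Derivable Ax Γ φ = ∃[ φs ] Derivation Ax Γ (φ ∷ φs)

  Theorem : Pred (Form ℕ) 0ℓ → Form P → Set
  Theorem Ax φ = Derivable Ax ∅ φ

Sound : Set → Pred (Form ℕ) 0ℓ → FrameClass → Set₁
Sound P Ax C = (φ : Form P) → Theorem Ax φ → ∀ F → F ∈ C → F ⊩ φ

StronglyComplete : Set → Pred (Form ℕ) 0ℓ → FrameClass → Set₁
StronglyComplete P Ax C =
  (Γ : Pred (Form P) 0ℓ) (φ : Form P) → Entails C Γ φ → Derivable Ax Γ φ

{-# OPTIONS --safe #-}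
-- In the canonical model let s R t when every φ with ▲ φ and φ in s belongs to
-- t.  Since ▲ φ and ▲ ~ φ are equivalent, this handles both halves of the truth
-- condition of ▲.  The relation is reflexive outright, and transitive by the
-- axiom ▲ p ⇒ ▲ ▲ p, so a single model serves both frame classes.  Its points
-- must form a small type, so they are Bool-valued maximal consistent sets;
-- excluded middle lets Bool act as an impredicative type of propositions, and
-- Lindenbaum's lemma is obtained from Zermelo's argument that a tower generated
-- by successors and unions is linearly ordered.
module Submission where

open import Axiom.ExcludedMiddle using (ExcludedMiddle)
open import Axiom.Extensionality.Propositional using (Extensionality)
open import Data.Bool using (Bool; true; false; T) renaming (_∧_ to _&&_)
open import Data.Bool.Properties using (T-∧; T-≡)
open import Data.Empty using (⊥; ⊥-elim)
open import Data.List using (List; []; _∷_; _++_)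
open import Data.List.Membership.Propositional using () renaming (_∈_ to _∈ₗ_)
open import Data.List.Membership.Propositional.Properties using (∈-++⁺ˡ; ∈-++⁺ʳ)
open import Data.List.Relation.Unary.Any using (here; there)
open import Data.Nat using (ℕ)
open import Data.Product using (_×_; _,_; proj₁; proj₂; ∃-syntax)
open import Data.Sum using (_⊎_; inj₁; inj₂; map₁; map₂)
open import Data.Unit using (tt)
open import Function using (_∘_; id; Equivalence)
open import Level using (0ℓ)
open import Relation.Binary.PropositionalEquality using (_≡_; refl; sym; trans; subst)
open import Relation.Nullary using (Dec; ¬_; yes; no; ⌊_⌋; toWitness; fromWitness; decidable-stable)
open import Relation.Unary using (Pred; _∈_; _∉_; _⊆_; _⊈_; _∪_; ｛_｝; ∅)
open import Defs

-- Boolean-valued subsets, towers and maximal sets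

T-injective : ∀ {x y} → (T x → T y) → (T y → T x) → x ≡ y
T-injective {false} {false} _ _ = refl
T-injective {false} {true}  _ g = ⊥-elim (g tt)
T-injective {true}  {false} f _ = ⊥-elim (f tt)
T-injective {true}  {true}  _ _ = refl

module Subsets (em : ExcludedMiddle 0ℓ) (ext : Extensionality 0ℓ 0ℓ) {A : Set} where

  Subset : Set
  Subset = A → Bool

  ⟦_⟧ : Subset → Pred A 0ℓ
  ⟦ X ⟧ a = T (X a)

  -- A genuine equality lets `subst` carry comparisons through the arbitrary step function of a
  -- tower.
  ⟦⟧-antisym : ∀ {X Y} → ⟦ X ⟧ ⊆ ⟦ Y ⟧ → ⟦ Y ⟧ ⊆ ⟦ X ⟧ → X ≡ Y
  ⟦⟧-antisym X⊆Y Y⊆X = ext λ _ → T-injective X⊆Y Y⊆X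

  ⋃ : (Subset → Bool) → Subset
  ⋃ C a = ⌊ em {∃[ X ] (T (C X) × a ∈ ⟦ X ⟧)} ⌋

  ∈-⋃⁻ : ∀ C {a} → a ∈ ⟦ ⋃ C ⟧ → ∃[ X ] (T (C X) × a ∈ ⟦ X ⟧)
  ∈-⋃⁻ C = toWitness

  ⊆-⋃ : ∀ {C X} → T (C X) → ⟦ X ⟧ ⊆ ⟦ ⋃ C ⟧
  ⊆-⋃ X∈C a∈X = fromWitness (_ , X∈C , a∈X)

  insert : Subset → A → Subset
  insert X a b = ⌊ em {(⟦ X ⟧ ∪ ｛ a ｝) b} ⌋

  Chain : (Subset → Bool) → Set
  Chain C = ∀ X Y → T (C X) → T (C Y) → ⟦ X ⟧ ⊆ ⟦ Y ⟧ ⊎ ⟦ Y ⟧ ⊆ ⟦ X ⟧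

  module Towers (f : Subset → Subset) (f-inflationary : ∀ X → ⟦ X ⟧ ⊆ ⟦ f X ⟧) where

    -- The empty set enters as the union of the empty family.
    data Tower : Subset → Set where
      successor : ∀ {X} → Tower X → Tower (f X)
      union     : ∀ C → (∀ X → T (C X) → Tower X) → Tower (⋃ C)

    Extreme : Subset → Set
    Extreme Y = ∀ {X} → Tower X → ⟦ X ⟧ ⊆ ⟦ Y ⟧ → ⟦ Y ⟧ ⊈ ⟦ X ⟧ → ⟦ f X ⟧ ⊆ ⟦ Y ⟧

    -- Induction on the tower of `X`. A successor of a set strictly below `Y` stays below by
    -- extremity, and a successor of `Y` itself is `f Y`. For a union, either some member contains
    -- `f Y` or all lie inside `Y`.
    extreme-compare : ∀ {Y} → Extreme Y → ∀ {X} → Tower X → ⟦ X ⟧ ⊆ ⟦ Y ⟧ ⊎ ⟦ f Y ⟧ ⊆ ⟦ X ⟧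
    extreme-compare {Y} eY (successor {X} tX) with extreme-compare eY tX
    ... | inj₂ fY⊆X = inj₂ (f-inflationary X ∘ fY⊆X)
    ... | inj₁ X⊆Y with em {⟦ Y ⟧ ⊆ ⟦ X ⟧}
    ...   | yes Y⊆X = inj₂ (subst (λ Z → ⟦ f Y ⟧ ⊆ ⟦ f Z ⟧) (⟦⟧-antisym Y⊆X X⊆Y) id)
    ...   | no  Y⊈X = inj₁ (eY tX X⊆Y Y⊈X)
    extreme-compare {Y} eY (union C tC) with em {∃[ X ] (T (C X) × ⟦ f Y ⟧ ⊆ ⟦ X ⟧)}
    ... | yes (X , X∈C , fY⊆X) = inj₂ (⊆-⋃ X∈C ∘ fY⊆X)
    ... | no  none = inj₁ λ a∈⋃ → let (X , X∈C , a∈X) = ∈-⋃⁻ C a∈⋃ in below X X∈C a∈X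
      where
      below : ∀ X → T (C X) → ⟦ X ⟧ ⊆ ⟦ Y ⟧
      below X X∈C with extreme-compare eY (tC X X∈C)
      ... | inj₁ X⊆Y  = X⊆Y
      ... | inj₂ fY⊆X = ⊥-elim (none (X , X∈C , fY⊆X))

    -- Induction on the tower of `Y`. In the union case some member `Z` is not inside `X`, so `X`
    -- lies strictly below `Z`, and extremity of `Z` applies.
    extreme : ∀ {Y} → Tower Y → Extreme Y
    extreme (successor {Y} tY) {X} tX X⊆fY fY⊈X with extreme-compare (extreme tY) tX
    ... | inj₂ fY⊆X = ⊥-elim (fY⊈X fY⊆X)
    ... | inj₁ X⊆Y with em {⟦ Y ⟧ ⊆ ⟦ X ⟧}
    ...   | yes Y⊆X = subst (λ Z → ⟦ f X ⟧ ⊆ ⟦ f Z ⟧) (⟦⟧-antisym X⊆Y Y⊆X) id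
    ...   | no  Y⊈X = f-inflationary Y ∘ extreme tY tX X⊆Y Y⊈X
    extreme (union C tC) {X} tX X⊆⋃ ⋃⊈X with em {∃[ Z ] (T (C Z) × ⟦ Z ⟧ ⊈ ⟦ X ⟧)}
    ... | no  none = ⊥-elim (⋃⊈X λ a∈⋃ → let (Z , Z∈C , a∈Z) = ∈-⋃⁻ C a∈⋃ in
            decidable-stable (em {⟦ Z ⟧ ⊆ ⟦ X ⟧}) (λ Z⊈X → none (Z , Z∈C , Z⊈X)) a∈Z)
    ... | yes (Z , Z∈C , Z⊈X) with extreme-compare (extreme (tC Z Z∈C)) tX
    ...   | inj₁ X⊆Z  = ⊆-⋃ Z∈C ∘ extreme (tC Z Z∈C) tX X⊆Z Z⊈X
    ...   | inj₂ fZ⊆X = ⊥-elim (Z⊈X (fZ⊆X ∘ f-inflationary Z))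

    tower-linear : ∀ {X Y} → Tower X → Tower Y → ⟦ X ⟧ ⊆ ⟦ Y ⟧ ⊎ ⟦ Y ⟧ ⊆ ⟦ X ⟧
    tower-linear {Y = Y} tX tY with extreme-compare (extreme tY) tX
    ... | inj₁ X⊆Y  = inj₁ X⊆Y
    ... | inj₂ fY⊆X = inj₂ (fY⊆X ∘ f-inflationary Y)

    inTower : Subset → Bool
    inTower X = ⌊ em {Tower X} ⌋

    top : Subset
    top = ⋃ inTower

    top-tower : Tower top
    top-tower = union inTower λ _ → toWitness

    -- The tower contains its own union, whose successor is therefore one of the sets united.
    top-fixed : ⟦ f top ⟧ ⊆ ⟦ top ⟧
    top-fixed = ⊆-⋃ {inTower} (fromWitness (successor top-tower))

  module Maximal (Good : Pred Subset 0ℓ)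
                 (good-⋃ : ∀ C → Chain C → (∀ X → T (C X) → Good X) → Good (⋃ C)) where

    Extension : Subset → Set
    Extension X = ∃[ a ] (a ∉ ⟦ X ⟧ × Good (insert X a))

    -- Deciding the sigma type `Extension X` yields an actual element, so excluded middle also
    -- supplies the choice function.
    extend : Subset → Subset
    extend X with em {Extension X}
    ... | yes (a , _) = insert X a
    ... | no _        = X

    extend-inflationary : ∀ X → ⟦ X ⟧ ⊆ ⟦ extend X ⟧
    extend-inflationary X with em {Extension X}
    ... | yes _ = fromWitness ∘ inj₁
    ... | no _  = id

    extend-good : ∀ {X} → Good X → Good (extend X)
    extend-good {X} gX with em {Extension X}
    ... | yes (_ , _ , g) = g
    ... | no _            = gX

    fixed⇒maximal : ∀ {X} → ⟦ extend X ⟧ ⊆ ⟦ X ⟧ → ∀ {a} → Good (insert X a) → a ∈ ⟦ X ⟧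
    fixed⇒maximal {X} fixed {a} g with em {Extension X}
    ... | yes (b , b∉X , _) = ⊥-elim (b∉X (fixed (fromWitness (inj₂ refl))))
    ... | no none = decidable-stable em λ a∉X → none (a , a∉X , g)

    open Towers extend extend-inflationary

    tower-good : ∀ {X} → Tower X → Good X
    tower-good (successor tX) = extend-good (tower-good tX)
    tower-good (union C tC)   =
      good-⋃ C (λ X Y X∈C Y∈C → tower-linear (tC X X∈C) (tC Y Y∈C)) λ X X∈C → tower-good (tC X X∈C)

    maximal : ∃[ X ] (Good X × (∀ {a} → Good (insert X a) → a ∈ ⟦ X ⟧))
    maximal = top , tower-good top-tower , fixed⇒maximal top-fixed

-- Operations on derivation sequences

module _ {P : Set} {Ax : Pred (Form ℕ) 0ℓ} where

  step-weaken : ∀ {Γ : Pred (Form P) 0ℓ} {Δ φs ψs φ} → Γ ⊆ Δ → (∀ {χ} → χ ∈ₗ φs → χ ∈ₗ ψs) →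
                Step Ax Γ φs φ → Step Ax Δ ψs φ
  step-weaken Γ⊆Δ φs⊆ψs (axiom i) = axiom i
  step-weaken Γ⊆Δ φs⊆ψs (hyp h)   = hyp (Γ⊆Δ h)
  step-weaken Γ⊆Δ φs⊆ψs (mp i j)  = mp (φs⊆ψs i) (φs⊆ψs j)
  step-weaken Γ⊆Δ φs⊆ψs (R i)     = R (φs⊆ψs i)

  derivation-weaken : ∀ {Γ : Pred (Form P) 0ℓ} {Δ φs} → Γ ⊆ Δ →
                      Derivation Ax Γ φs → Derivation Ax Δ φs
  derivation-weaken Γ⊆Δ []      = []
  derivation-weaken Γ⊆Δ (s ∷ d) = step-weaken Γ⊆Δ id s ∷ derivation-weaken Γ⊆Δ d

  derivation-++ : ∀ {Γ : Pred (Form P) 0ℓ} {φs ψs} →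
                  Derivation Ax Γ φs → Derivation Ax Γ ψs → Derivation Ax Γ (φs ++ ψs)
  derivation-++ []      e = e
  derivation-++ (s ∷ d) e = step-weaken id ∈-++⁺ˡ s ∷ derivation-++ d e

  derivable-mp : ∀ {Γ : Pred (Form P) 0ℓ} {φ ψ} →
                 Derivable Ax Γ (φ ⇒ ψ) → Derivable Ax Γ φ → Derivable Ax Γ ψ
  derivable-mp (φs , d) (ψs , e) =
    _ , mp (here refl) (∈-++⁺ʳ (_ ∷ φs) (here refl)) ∷ derivation-++ d e

  derivable-R : ∀ {Γ : Pred (Form P) 0ℓ} {φ ψ} →
                Derivable Ax Γ (φ ⇒ ψ) → Derivable Ax Γ (▲ φ ∧ φ ⇒ ▲ ψ)
  derivable-R (_ , d) = _ , R (here refl) ∷ d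

  derivable-axiom : ∀ {Γ : Pred (Form P) 0ℓ} {α} → α ∈ Ax →
                    (σ : ℕ → Form P) → Derivable Ax Γ (α [ σ ])
  derivable-axiom α∈Ax σ = [] , axiom (_ , σ , α∈Ax , refl) ∷ []

-- Soundness

module Soundness (em : ExcludedMiddle 0ℓ) {P : Set} where

  ⇒-intro : ∀ (M : Model P) {s φ ψ} → (M , s ⊨ φ → M , s ⊨ ψ) → M , s ⊨ φ ⇒ ψ
  ⇒-intro M f (x , ¬y) = ¬y (f x)

  ⇒-elim : ∀ (M : Model P) {s φ ψ} → M , s ⊨ φ ⇒ ψ → M , s ⊨ φ → M , s ⊨ ψ
  ⇒-elim M f x = decidable-stable em λ ¬y → f (x , ¬y)

  -- At a fixed point the connectives act as Boolean operations. A tautology can thus be evaluated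
  -- at the valuation that reads off the truth of each `σ n` there.
  truthValue-⊨ : ∀ (M : Model P) s (σ : ℕ → Form P) {α} (a : Propositional α) →
                 truthValue a (λ n → ⌊ em {M , s ⊨ σ n} ⌋) ≡ ⌊ em {M , s ⊨ α [ σ ]} ⌋
  truthValue-⊨ M s σ ⊤ = T-injective (λ _ → fromWitness tt) (λ _ → tt)
  truthValue-⊨ M s σ (var n) = refl
  truthValue-⊨ M s σ {~ α} (~ a) rewrite truthValue-⊨ M s σ a
    with em {M , s ⊨ α [ σ ]} | em {M , s ⊨ (~ α) [ σ ]}
  ... | yes x | yes ¬x = ⊥-elim (¬x x)
  ... | yes _ | no  _  = refl
  ... | no  _ | yes _  = refl
  ... | no ¬x | no ¬¬x = ⊥-elim (¬¬x ¬x)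
  truthValue-⊨ M s σ {α ∧ β} (a ∧ b) rewrite truthValue-⊨ M s σ a | truthValue-⊨ M s σ b
    with em {M , s ⊨ α [ σ ]} | em {M , s ⊨ β [ σ ]} | em {M , s ⊨ (α ∧ β) [ σ ]}
  ... | yes _ | yes _ | yes _ = refl
  ... | yes x | yes y | no ¬z = ⊥-elim (¬z (x , y))
  ... | yes _ | no ¬y | yes z = ⊥-elim (¬y (proj₂ z))
  ... | yes _ | no _  | no _  = refl
  ... | no ¬x | _     | yes z = ⊥-elim (¬x (proj₁ z))
  ... | no _  | _     | no _  = refl

  axiom-valid : ∀ F → F ∈ 4-frames → ∀ {α} → α ∈ K4▲ → (σ : ℕ → Form P) → F ⊩ α [ σ ]
  axiom-valid F R-trans (inj₁ (taut (a , a-true))) σ V s =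
    toWitness (subst T (trans (sym (a-true _)) (truthValue-⊨ ⟨ F , V ⟩ s σ a)) tt)
  axiom-valid F R-trans (inj₁ ▲⊤) σ V s = (λ _ _ _ → tt) , λ ¬⊤ _ _ _ → ¬⊤ tt
  axiom-valid F R-trans (inj₁ ▲~) σ V s =
      -- Negation swaps the two clauses of `▲`, up to double negation.
      ⇒-intro M {φ = ▲ ~ σ 0} {ψ = ▲ σ 0} (λ (f , g) →
        (λ x t r → decidable-stable em (g (λ ¬x → ¬x x) t r)) , f)
    , ⇒-intro M {φ = ▲ σ 0} {ψ = ▲ ~ σ 0} (λ (f , g) →
        g , λ ¬¬x t r ¬y → ¬y (f (decidable-stable em ¬¬x) t r))
    where M = ⟨ F , V ⟩
  axiom-valid F R-trans (inj₁ ▲∧) σ V s =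
    ⇒-intro M {φ = ▲ σ 0 ∧ ▲ σ 1} {ψ = ▲ (σ 0 ∧ σ 1)} λ ((f , g) , (h , k)) →
        (λ (x , y) t r → f x t r , h y t r)
      , λ ¬xy t r (x , y) →
          g (λ x′ → k (λ y′ → ¬xy (x′ , y′)) t r y) t r x
    where M = ⟨ F , V ⟩
  axiom-valid F R-trans (inj₂ refl) σ V s =
    ⇒-intro M {φ = ▲ σ 0} {ψ = ▲ ▲ σ 0} λ (f , g) →
        -- By transitivity `t` and `u` are both successors of `s`, so each agrees with `s` about
        -- `σ 0`.
        (λ _ t r → (λ x u r′ → decidable-stable em λ ¬y →
                      g (λ x′ → ¬y (f x′ u (R-trans r r′))) t r x)
                 , (λ ¬x u r′ → g (λ x′ → ¬x (f x′ t r)) u (R-trans r r′)))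
      , λ ¬▲ → ⊥-elim (¬▲ (f , g))
    where M = ⟨ F , V ⟩

  derivation-sound : ∀ F → F ∈ 4-frames → ∀ {φs : List (Form P)} → Derivation K4▲ ∅ φs →
                     ∀ {φ} → φ ∈ₗ φs → F ⊩ φ
  derivation-sound F t (s ∷ d) (there i) = derivation-sound F t d i
  derivation-sound F t (axiom (α , σ , α∈Ax , refl) ∷ d) (here refl) = axiom-valid F t α∈Ax σ
  derivation-sound F t (hyp () ∷ d) (here refl)
  derivation-sound F t (mp {φ} {ψ} i j ∷ d) (here refl) V s =
    ⇒-elim ⟨ F , V ⟩ {φ = φ} {ψ = ψ} (derivation-sound F t d i V s) (derivation-sound F t d j V s)
  derivation-sound F t (R {φ} {ψ} i ∷ d) (here refl) V s =
    ⇒-intro M {φ = ▲ φ ∧ φ} {ψ = ▲ ψ} λ ((f , _) , x) →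
        -- As `φ` holds at `s`, so does `ψ`, and the negative clause is vacuous.
        (λ _ u r → valid u (f x u r)) , λ ¬y → ⊥-elim (¬y (valid s x))
    where
    M = ⟨ F , V ⟩
    valid : ∀ u → M , u ⊨ φ → M , u ⊨ ψ
    valid u = ⇒-elim M {φ = φ} {ψ = ψ} (derivation-sound F t d i V u)

  sound : Sound P K4▲ 4-frames
  sound φ (_ , d) F t = derivation-sound F t d (here refl)

-- Local derivability

letters : ∀ {A : Set} → A → A → A → ℕ → A
letters x y z 0 = x
letters x y z 1 = y
letters x y z _ = z

instance
  propositional-⊤ : ∀ {P} → Propositional {P} ⊤
  propositional-⊤ = ⊤

  propositional-var : ∀ {P} {x : P} → Propositional (var x)
  propositional-var = var _

  propositional-~ : ∀ {P} {φ : Form P} → {{Propositional φ}} → Propositional (~ φ)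
  propositional-~ {{a}} = ~ a

  propositional-∧ : ∀ {P} {φ ψ : Form P} → {{Propositional φ}} → {{Propositional ψ}} →
                    Propositional (φ ∧ ψ)
  propositional-∧ {{a}} {{b}} = a ∧ b

every : (Bool → Bool) → Bool
every f = f true && f false

every-elim : ∀ f → T (every f) → ∀ x → T (f x)
every-elim f h true  = proj₁ (Equivalence.to T-∧ h)
every-elim f h false = proj₂ (Equivalence.to (T-∧ {f true}) h)

module _ {P : Set} where

  -- The equation (refl in each use) says that α has no letters besides 0, 1, 2,
  -- so that its truth table can be evaluated.
  tautology : ∀ α {{a : Propositional α}} →
              let table x y z = truthValue a (letters x y z) in
              (∀ v → truthValue a v ≡ table (v 0) (v 1) (v 2)) →
              {T (every λ x → every λ y → every λ z → table x y z)} →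
              ∀ {φ ψ χ : Form P} → Theorem K4▲ (α [ letters φ ψ χ ])
  tautology α {{a}} three-letters {valid} {φ} {ψ} {χ} =
    derivable-axiom (inj₁ (taut (a , λ v → trans (three-letters v) (Equivalence.to T-≡ (lookup v)))))
      (letters φ ψ χ)
    where
    lookup : ∀ v → T (truthValue a (letters (v 0) (v 1) (v 2)))
    lookup v = every-elim (λ z → truthValue a (letters (v 0) (v 1) z))
      (every-elim (λ y → every λ z → truthValue a (letters (v 0) y z))
        (every-elim (λ x → every λ y → every λ z → truthValue a (letters x y z)) valid (v 0))
        (v 1))
      (v 2)

  infix 4 _⊢_

  -- Unlike in Derivable, rule R applies to theorems only.
  data _⊢_ (X : Pred (Form P) 0ℓ) : Form P → Set where
    thm : ∀ {φ} → Theorem K4▲ φ → X ⊢ φ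
    hyp : ∀ {φ} → φ ∈ X → X ⊢ φ
    mp  : ∀ {φ ψ} → X ⊢ φ ⇒ ψ → X ⊢ φ → X ⊢ ψ

  ⊢-weaken : ∀ {X Y φ} → X ⊆ Y → X ⊢ φ → Y ⊢ φ
  ⊢-weaken X⊆Y (thm t)  = thm t
  ⊢-weaken X⊆Y (hyp h)  = hyp (X⊆Y h)
  ⊢-weaken X⊆Y (mp d e) = mp (⊢-weaken X⊆Y d) (⊢-weaken X⊆Y e)

  ⊢⇒derivable : ∀ {X φ} → X ⊢ φ → Derivable K4▲ X φ
  ⊢⇒derivable (thm (_ , d)) = _ , derivation-weaken (λ ()) d
  ⊢⇒derivable (hyp h)       = [] , hyp h ∷ []
  ⊢⇒derivable (mp d e)      = derivable-mp (⊢⇒derivable d) (⊢⇒derivable e)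

  -- Works because `R` never acts on hypotheses. It fails for `Derivable`: a variable `x` yields
  -- `▲ x` there, but `x ⇒ ▲ x` is not a theorem.
  deduction : ∀ {X φ ψ} → X ∪ ｛ φ ｝ ⊢ ψ → X ⊢ φ ⇒ ψ
  deduction (thm t)           = mp (thm (tautology (p ⇒ q ⇒ p) (λ _ → refl) {χ = ⊤})) (thm t)
  deduction (hyp (inj₁ h))    = mp (thm (tautology (p ⇒ q ⇒ p) (λ _ → refl) {χ = ⊤})) (hyp h)
  deduction (hyp (inj₂ refl)) = thm (tautology (p ⇒ p) (λ _ → refl) {ψ = ⊤} {⊤})
  deduction (mp d e)          =
    mp (mp (thm (tautology ((p ⇒ q ⇒ var 2) ⇒ (p ⇒ q) ⇒ p ⇒ var 2) (λ _ → refl)))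
           (deduction d))
       (deduction e)

  ∧-intro : ∀ {X φ ψ} → X ⊢ φ → X ⊢ ψ → X ⊢ φ ∧ ψ
  ∧-intro d e = mp (mp (thm (tautology (p ⇒ q ⇒ p ∧ q) (λ _ → refl) {χ = ⊤})) d) e

  ∧-elimˡ : ∀ {X φ ψ} → X ⊢ φ ∧ ψ → X ⊢ φ
  ∧-elimˡ = mp (thm (tautology (p ∧ q ⇒ p) (λ _ → refl) {χ = ⊤}))

  ∧-elimʳ : ∀ {X φ ψ} → X ⊢ φ ∧ ψ → X ⊢ ψ
  ∧-elimʳ = mp (thm (tautology (p ∧ q ⇒ q) (λ _ → refl) {χ = ⊤}))

  ~-elim : ∀ {X φ} → X ⊢ ~ φ → X ⊢ φ → X ⊢ ~ ⊤
  ~-elim d e = mp (mp (thm (tautology (~ p ⇒ p ⇒ ~ ⊤) (λ _ → refl) {ψ = ⊤} {⊤})) d) e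

  ~-intro : ∀ {X φ} → X ∪ ｛ φ ｝ ⊢ ~ ⊤ → X ⊢ ~ φ
  ~-intro d = mp (thm (tautology ((p ⇒ ~ ⊤) ⇒ ~ p) (λ _ → refl) {ψ = ⊤} {⊤})) (deduction d)

  by-contradiction : ∀ {X φ} → X ∪ ｛ ~ φ ｝ ⊢ ~ ⊤ → X ⊢ φ
  by-contradiction d = mp (thm (tautology ((~ p ⇒ ~ ⊤) ⇒ p) (λ _ → refl) {ψ = ⊤} {⊤})) (deduction d)

  ▲-mono : ∀ {X φ ψ} → Theorem K4▲ (φ ⇒ ψ) → X ⊢ ▲ φ → X ⊢ φ → X ⊢ ▲ ψ
  ▲-mono t d e = mp (thm (derivable-R t)) (∧-intro d e)

  -- Necessitation, obtained from `▲ ⊤` by applying `R` to `⊤ ⇒ φ`.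
  ▲-theorem : ∀ {X φ} → Theorem K4▲ φ → X ⊢ ▲ φ
  ▲-theorem t =
    ▲-mono (derivable-mp (tautology (p ⇒ q ⇒ p) (λ _ → refl) {χ = ⊤}) t)
      (thm (derivable-axiom (inj₁ ▲⊤) (λ _ → ⊤))) (thm (tautology ⊤ (λ _ → refl) {φ = ⊤} {⊤} {⊤}))

  -- A relative of axiom K: `R` asks for the truth of `(φ ⇒ ψ) ∧ φ` besides its `▲`, whence the
  -- unboxed premises.
  ▲-mp : ∀ {X φ ψ} → X ⊢ ▲ (φ ⇒ ψ) → X ⊢ φ ⇒ ψ → X ⊢ ▲ φ → X ⊢ φ → X ⊢ ▲ ψ
  ▲-mp {φ = φ} {ψ} ▲i i ▲x x =
    ▲-mono (tautology ((p ⇒ q) ∧ p ⇒ q) (λ _ → refl) {χ = ⊤})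
      (mp (thm (derivable-axiom (inj₁ ▲∧) (letters (φ ⇒ ψ) φ ⊤))) (∧-intro ▲i ▲x))
      (∧-intro i x)

  ▲-~ : ∀ {X φ} → X ⊢ ▲ φ → X ⊢ ▲ ~ φ
  ▲-~ {φ = φ} = mp (∧-elimʳ (thm (derivable-axiom (inj₁ ▲~) (λ _ → φ))))

  ▲-~⁻ : ∀ {X φ} → X ⊢ ▲ ~ φ → X ⊢ ▲ φ
  ▲-~⁻ {φ = φ} = mp (∧-elimˡ (thm (derivable-axiom (inj₁ ▲~) (λ _ → φ))))

  ▲-▲ : ∀ {X φ} → X ⊢ ▲ φ → X ⊢ ▲ ▲ φ
  ▲-▲ {φ = φ} = mp (thm (derivable-axiom (inj₂ refl) (λ _ → φ)))

-- Completeness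

module Completeness (em : ExcludedMiddle 0ℓ) (ext : Extensionality 0ℓ 0ℓ) {P : Set} where

  open Subsets em ext {Form P}

  -- A derivation uses finitely many members of the union, and a chain has one set holding them all.
  -- The left alternative covers the empty chain.
  ⊢-compact : ∀ {Γ : Pred (Form P) 0ℓ} C → Chain C → ∀ {φ} → Γ ∪ ⟦ ⋃ C ⟧ ⊢ φ →
              Γ ⊢ φ ⊎ ∃[ X ] (T (C X) × Γ ∪ ⟦ X ⟧ ⊢ φ)
  ⊢-compact C chain (thm t) = inj₁ (thm t)
  ⊢-compact C chain (hyp (inj₁ h)) = inj₁ (hyp h)
  ⊢-compact C chain (hyp (inj₂ h)) =
    let (X , X∈C , φ∈X) = ∈-⋃⁻ C h in inj₂ (X , X∈C , hyp (inj₂ φ∈X))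
  ⊢-compact {Γ} C chain (mp d e) with ⊢-compact C chain d | ⊢-compact C chain e
  ... | inj₁ d′ | inj₁ e′ = inj₁ (mp d′ e′)
  ... | inj₁ d′ | inj₂ (X , X∈C , e′) = inj₂ (X , X∈C , mp (⊢-weaken inj₁ d′) e′)
  ... | inj₂ (X , X∈C , d′) | inj₁ e′ = inj₂ (X , X∈C , mp d′ (⊢-weaken inj₁ e′))
  ... | inj₂ (X , X∈C , d′) | inj₂ (Y , Y∈C , e′) with chain X Y X∈C Y∈C
  ...   | inj₁ X⊆Y = inj₂ (Y , Y∈C , mp (⊢-weaken (map₂ X⊆Y) d′) e′)
  ...   | inj₂ Y⊆X = inj₂ (X , X∈C , mp d′ (⊢-weaken (map₂ Y⊆X) e′))

  record World : Set where
    field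
      set        : Subset
      closed     : ∀ {φ} → ⟦ set ⟧ ⊢ φ → φ ∈ ⟦ set ⟧
      consistent : ¬ ⟦ set ⟧ ⊢ ~ ⊤
      complete   : ∀ {φ} → φ ∉ ⟦ set ⟧ → ~ φ ∈ ⟦ set ⟧

  open World

  -- `Γ` need not be Boolean-valued, so it stays beside the growing set as a fixed context; closure
  -- of the maximal set absorbs it at the end.
  lindenbaum : ∀ {Γ : Pred (Form P) 0ℓ} → ¬ Γ ⊢ ~ ⊤ → ∃[ w ] Γ ⊆ ⟦ set w ⟧
  lindenbaum {Γ} Γ-consistent = w , λ h → X-closed (hyp (inj₁ h))
    where
    Consistent : Pred Subset 0ℓ
    Consistent X = ¬ (Γ ∪ ⟦ X ⟧ ⊢ ~ ⊤)

    consistent-⋃ : ∀ C → Chain C → (∀ X → T (C X) → Consistent X) → Consistent (⋃ C)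
    consistent-⋃ C chain con d with ⊢-compact C chain d
    ... | inj₁ e             = Γ-consistent e
    ... | inj₂ (X , X∈C , e) = con X X∈C e

    open Maximal Consistent consistent-⋃

    X : Subset
    X = proj₁ maximal

    X-consistent : Consistent X
    X-consistent = proj₁ (proj₂ maximal)

    insert⇒∪ : ∀ {φ ψ} → Γ ∪ ⟦ insert X φ ⟧ ⊢ ψ → (Γ ∪ ⟦ X ⟧) ∪ ｛ φ ｝ ⊢ ψ
    insert⇒∪ = ⊢-weaken λ where
      (inj₁ h) → inj₁ (inj₁ h)
      (inj₂ h) → map₁ inj₂ (toWitness h)

    X-closed : ∀ {φ} → Γ ∪ ⟦ X ⟧ ⊢ φ → φ ∈ ⟦ X ⟧
    X-closed d = proj₂ (proj₂ maximal) λ e → X-consistent (mp (deduction (insert⇒∪ e)) d)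

    w : World
    w = record
      { set        = X
      ; closed     = X-closed ∘ ⊢-weaken inj₂
      ; consistent = X-consistent ∘ ⊢-weaken inj₂
      ; complete   = λ φ∉X → X-closed (~-intro (insert⇒∪
          (decidable-stable em (φ∉X ∘ proj₂ (proj₂ maximal)))))
      }

  ~∈⇒∉ : ∀ w {φ} → ~ φ ∈ ⟦ set w ⟧ → φ ∉ ⟦ set w ⟧
  ~∈⇒∉ w h h′ = consistent w (~-elim (hyp h) (hyp h′))

  Essential : World → Pred (Form P) 0ℓ
  Essential w φ = ▲ φ ∈ ⟦ set w ⟧ × φ ∈ ⟦ set w ⟧

  -- Necessitation handles theorems and `▲-mp` handles modus ponens.
  essential-closed : ∀ w {φ} → Essential w ⊢ φ → Essential w φ
  essential-closed w (thm t)  = closed w (▲-theorem t) , closed w (thm t)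
  essential-closed w (hyp h)  = h
  essential-closed w (mp d e) =
    let (▲i , i) = essential-closed w d
        (▲x , x) = essential-closed w e
    in closed w (▲-mp (hyp ▲i) (hyp i) (hyp ▲x) (hyp x)) , closed w (mp (hyp i) (hyp x))

  canonicalFrame : World → Frame
  canonicalFrame w = record
    { S = World
    ; nonempty = w
    ; R = λ s t → Essential s ⊆ ⟦ set t ⟧
    }

  canonical : World → Model P
  canonical w = ⟨ canonicalFrame w , (λ x s → var x ∈ ⟦ set s ⟧) ⟩

  canonical-S4 : ∀ w → canonicalFrame w ∈ S4-frames
  canonical-S4 w = proj₂ , λ {s} {t} {u} sRt tRu (▲x , x) →
    -- `▲ φ` is itself essential at `s` by `▲-▲`, so `t` receives both `▲ φ` and `φ`, making `φ`
    -- essential at `t`.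
    tRu (sRt (closed s (▲-▲ (hyp ▲x)) , ▲x) , sRt (▲x , x))

  -- If `Essential s` were inconsistent with `~ φ`, it would derive `φ`, and its closure would put
  -- `▲ φ` into `s`.
  separate : ∀ s {φ} → φ ∈ ⟦ set s ⟧ → ▲ φ ∉ ⟦ set s ⟧ →
             ∃[ t ] (Essential s ⊆ ⟦ set t ⟧ × φ ∉ ⟦ set t ⟧)
  separate s φ∈s ▲φ∉s =
    let (t , h) = lindenbaum λ d → ▲φ∉s (proj₁ (essential-closed s (by-contradiction d)))
    in t , (λ e → h (inj₁ e)) , ~∈⇒∉ t (h (inj₂ refl))

  module _ (w : World) where

    mutual

      truth⁺ : ∀ φ s → φ ∈ ⟦ set s ⟧ → canonical w , s ⊨ φ
      truth⁺ ⊤       s h = tt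
      truth⁺ (var x) s h = h
      truth⁺ (~ φ)   s h = ~∈⇒∉ s h ∘ truth⁻ φ s
      truth⁺ (φ ∧ ψ) s h =
        truth⁺ φ s (closed s (∧-elimˡ (hyp h))) , truth⁺ ψ s (closed s (∧-elimʳ (hyp h)))
      truth⁺ (▲ φ)   s h =
          (λ x t r → truth⁺ φ t (r (h , truth⁻ φ s x)))
        -- Here `~ φ` is essential at `s`, so it is passed on to `t`.
        , (λ ¬x t r → ~∈⇒∉ t (r (closed s (▲-~ (hyp h)) , complete s (¬x ∘ truth⁺ φ s)))
                      ∘ truth⁻ φ t)

      truth⁻ : ∀ φ s → canonical w , s ⊨ φ → φ ∈ ⟦ set s ⟧
      truth⁻ ⊤       s h = closed s (thm (tautology ⊤ (λ _ → refl) {φ = ⊤} {⊤} {⊤}))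
      truth⁻ (var x) s h = h
      truth⁻ (~ φ)   s h = complete s (h ∘ truth⁺ φ s)
      truth⁻ (φ ∧ ψ) s (x , y) = closed s (∧-intro (hyp (truth⁻ φ s x)) (hyp (truth⁻ ψ s y)))
      truth⁻ (▲ φ)   s (f , g) = decidable-stable em λ ▲φ∉s → case-φ ▲φ∉s (em {φ ∈ ⟦ set s ⟧})
        where
        -- Whichever of `φ` and `~ φ` lies in `s` is omitted by some successor, against `f` or `g`
        -- respectively.
        case-φ : ▲ φ ∉ ⟦ set s ⟧ → Dec (φ ∈ ⟦ set s ⟧) → ⊥
        case-φ ▲φ∉s (yes φ∈s) =
          let (t , r , φ∉t) = separate s φ∈s ▲φ∉s
          in φ∉t (truth⁻ φ t (f (truth⁺ φ s φ∈s) t r))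
        case-φ ▲φ∉s (no φ∉s) =
          let (t , r , ~φ∉t) = separate s (complete s φ∉s) (▲φ∉s ∘ closed s ∘ ▲-~⁻ ∘ hyp)
          in ~φ∉t (complete t (g (φ∉s ∘ truth⁻ φ s) t r ∘ truth⁺ φ t))

  -- Local derivability implies `Derivable`, so an underivable `φ` leaves `Γ` with `~ φ` locally
  -- consistent, and a world containing both refutes the entailment.
  S4-complete : StronglyComplete P K4▲ S4-frames
  S4-complete Γ φ entails = decidable-stable em λ underivable →
    let (w , h) = lindenbaum λ d → underivable (⊢⇒derivable (by-contradiction d))
    in entails (canonicalFrame w) (canonical-S4 w) _ w λ {ψ} → truth⁺ w ψ w ∘ h

theorem54 : ExcludedMiddle 0ℓ → Extensionality 0ℓ 0ℓ → (P : Set) →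
    (Sound P K4▲ 4-frames × StronglyComplete P K4▲ 4-frames)
    × (Sound P K4▲ S4-frames × StronglyComplete P K4▲ S4-frames)
theorem54 em ext P =
    -- Entailment over all transitive frames restricts to the reflexive ones, so completeness passes
    -- to the larger class and soundness to the smaller.
    (sound , λ Γ φ entails → S4-complete Γ φ λ F → entails F ∘ proj₂)
  , ((λ φ t F → sound φ t F ∘ proj₂) , S4-complete)
  where
  open Soundness em
  open Completeness em ext
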